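{- Let $n\geq 1$ be an integer with binary expansion $n=\sum_{i=0}^{\lfloor\log n\rfloor}b_i2^i$, $b_i\in\{0,1\}$. Then the largest number $r(n)$ of red internal nodes in a red-black tree on $n$ keys is $$r(n)=\frac13\bigl(2n+a(n)+o(n)\bigr)-\left\lfloor\frac{\lfloor\log n\rfloor+1}{2}\right\rfloor,$$ where $a(n)$ and $o(n)$ are the binary weight and the odd binary weight of $n$, respectively.
   Context: Here $\log$ denotes the base-2 logarithm. A (relaxed) red-black tree on $n$ keys is a binary search tree with $n$ internal nodes (the nodes holding keys), in which every missing child is regarded as a leaf (NIL), together with a coloring of its nodes such that: each node is either red or black; all leaves (NIL) are black; every red node has two black children (NIL leaves count as black); and, for every node, every path from that node to a descendant leaf contains the same number of black nodes. The root may be red or black. $r(n)$ denotes the maximum, over all red-black trees on $n$ keys, of the number of red internal nodes. For $n=\sum_{i=0}^{\lfloor\log n\rfloor}b_i2^i$ with $b_i\in\{0,1\}$, the binary weight is $a(n)=\sum_{i=0}^{\lfloor\log n\rfloor}b_i$ (the number of 1's in the binary expansion), and the odd binary weight is $o(n)=\sum_{i=0}^{\lfloor(\lfloor\log n\rfloor-1)/2\rfloor}b_{2i+1}$ (the number of 1's in odd positions, position $0$ being the least significant bit; the sum is empty, equal to $0$, for $n=1$). -}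

module Defs where

open import Data.Digit using (Bit)
open import Data.Fin using (toℕ)
open import Data.Integer using (+_)
open import Data.List using (List; []; _∷_; _++_; sum; applyUpTo)
open import Data.List.Relation.Unary.All using (All)
open import Data.Nat using (ℕ; suc; _+_; _*_; _^_; _≤_; _<_; _>_; ⌊_/2⌋)
open import Data.Nat.Logarithm using (⌊log₂_⌋)
open import Data.Product using (_×_; ∃-syntax)
open import Data.Rational using (ℚ; _/_)
open import Data.Unit using (⊤)
open import Relation.Binary.PropositionalEquality using (_≡_)

data Colour : Set where
  red black : Colour

-- NIL leaves carry no key; they are black by the definition of `colour`.
data Tree : Set where
  leaf : Tree
  node : Colour → Tree → ℕ → Tree → Tree

colour : Tree → Colour
colour leaf           = black
colour (node c _ _ _) = c

size : Tree → ℕ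
size leaf           = 0
size (node _ l _ r) = suc (size l + size r)

redCount : Tree → ℕ
redCount leaf               = 0
redCount (node red   l _ r) = suc (redCount l + redCount r)
redCount (node black l _ r) = redCount l + redCount r

keys : Tree → List ℕ
keys leaf           = []
keys (node _ l k r) = keys l ++ k ∷ keys r

-- P holds at every node (NIL leaves included), a node being identified with
-- the subtree rooted at it.
Everywhere : (Tree → Set) → Tree → Set
Everywhere P leaf             = P leaf
Everywhere P t@(node _ l _ r) = P t × Everywhere P l × Everywhere P r

KeysOrdered : Tree → Set
KeysOrdered leaf           = ⊤
KeysOrdered (node _ l k r) = All (_< k) (keys l) × All (_> k) (keys r)

BlackChildrenIfRed : Tree → Set
BlackChildrenIfRed leaf           = ⊤
BlackChildrenIfRed (node c l _ r) = c ≡ red → colour l ≡ black × colour r ≡ black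

-- Paths from the root to a leaf.
data LeafPath : Tree → Set where
  stop  : LeafPath leaf
  left  : ∀ {c l k r} → LeafPath l → LeafPath (node c l k r)
  right : ∀ {c l k r} → LeafPath r → LeafPath (node c l k r)

isBlack : Colour → ℕ
isBlack red   = 0
isBlack black = 1

-- Both endpoints count, so the final NIL leaf contributes 1.
blackCount : ∀ {t} → LeafPath t → ℕ
blackCount stop              = isBlack (colour leaf)
blackCount (left  {c = c} p) = isBlack c + blackCount p
blackCount (right {c = c} p) = isBlack c + blackCount p

BlackBalanced : Tree → Set
BlackBalanced t = (p q : LeafPath t) → blackCount p ≡ blackCount q

-- Relaxed: the root may have either colour.
record IsRedBlack (t : Tree) : Set where
  field
    ordered  : Everywhere KeysOrdered t
    redRule  : Everywhere BlackChildrenIfRed t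
    balanced : Everywhere BlackBalanced t

-- m is the maximum r(n).
record IsMaxRedCount (n m : ℕ) : Set where
  field
    attained   : ∃[ t ] (IsRedBlack t × size t ≡ n × redCount t ≡ m)
    upperBound : ∀ t → IsRedBlack t → size t ≡ n → redCount t ≤ m

∑< : ℕ → (ℕ → ℕ) → ℕ
∑< n f = sum (applyUpTo f n)

syntax ∑< n (λ i → e) = ∑[ i < n ] e

-- Bits are indexed from the least significant one; the values of b beyond
-- position ⌊log₂ n⌋ are never used.
IsBinaryExpansion : ℕ → (ℕ → Bit) → Set
IsBinaryExpansion n b = n ≡ ∑[ i < suc ⌊log₂ n ⌋ ] (toℕ (b i) * 2 ^ i)

-- In the next two definitions b is the binary expansion of n.
binaryWeight : ℕ → (ℕ → Bit) → ℕ
binaryWeight n b = ∑[ i < suc ⌊log₂ n ⌋ ] toℕ (b i)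

-- The last index is ⌊(⌊log₂ n⌋ - 1)/2⌋, so there are ⌊(⌊log₂ n⌋ + 1)/2⌋ terms.
oddBinaryWeight : ℕ → (ℕ → Bit) → ℕ
oddBinaryWeight n b = ∑[ i < ⌊ suc ⌊log₂ n ⌋ /2⌋ ] toℕ (b (2 * i + 1))

ι : ℕ → ℚ
ι m = + m / 1

{-# OPTIONS --safe #-}

-- A tree with balanced black height h has k₀ = n + 1 leaves, and the number kᵢ of its
-- black nodes at black height i satisfies kᵢ₊₁ ≥ ⌈kᵢ / 4⌉: a black node has at most two
-- children, and each red one among them has two black children.
-- Conversely, starting from a tree on ⌊n / 4⌋ keys, whose number of leaves is
-- ⌈(n + 1) / 4⌉, one obtains a tree on n keys by replacing each leaf by a black
-- node with zero, one or two red children.  So the least number of black nodes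
-- satisfies f(n) = ⌊n / 4⌋ + 1 + f(⌊n / 4⌋) for n ≥ 2, and each step of this
-- recursion strips two binary digits off n.
module Submission where

open import Defs
open import Data.Digit using (Bit)
open import Data.Fin using (toℕ)
open import Data.Fin.Properties using (toℕ<n)
open import Data.Integer as ℤ using (+_)
import Data.Integer.Properties as ℤ
open import Data.List.Relation.Unary.All as All using (All; []; _∷_)
import Data.List.Relation.Unary.All.Properties as All
open import Data.Nat using (ℕ; zero; suc; _+_; _*_; _^_; _≤_; _<_; z≤n; s≤s; s≤s⁻¹; ⌊_/2⌋)
import Data.Nat as ℕ
open import Data.Nat.DivMod using (_%_; /-monoˡ-≤; m<n*o⇒m/o<n; m<n⇒m/n≡0; m*n/n≡m; +-distrib-/-∣ʳ; m≡m%n+[m/n]*n; m%n<n; m/n≡1+[m∸n]/n)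
open import Data.Nat.Divisibility using (n∣m*n)
open import Data.Nat.Logarithm using (⌊log₂_⌋; ⌊log₂⌊n/2⌋⌋≡⌊log₂n⌋∸1)
open import Data.Nat.Induction using (<-rec)
open import Data.Nat.Properties
open import Algebra.Properties.CommutativeSemigroup +-commutativeSemigroup using (interchange)
open import Data.Nat.Tactic.RingSolver using (solve-∀)
open import Data.Product using (_×_; ∃-syntax; _,_; proj₁; proj₂)
open import Data.Rational as ℚ using (_/_)
import Data.Rational.Properties as ℚ
open import Data.Rational.Unnormalised as ℚᵘ using (mkℚᵘ; *≡*)
import Data.Rational.Unnormalised.Properties as ℚᵘ
open import Data.Unit using (tt)
open import Function using (_∘_)
open import Relation.Binary.PropositionalEquality using (_≡_; refl; sym; trans; cong; cong₂; subst; module ≡-Reasoning)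

-- Red-black trees indexed by root colour and black height

-- Here h counts the black internal nodes on each path, so it is one less than blackCount.
data RB : Colour → ℕ → Tree → Set where
  leaf  : RB black 0 leaf
  red   : ∀ {h l k r} → RB black h l → RB black h r → RB red h (node red l k r)
  black : ∀ {c c′ h l k r} → RB c h l → RB c′ h r → RB black (suc h) (node black l k r)

blacks : Tree → ℕ
blacks leaf               = 0
blacks (node red   l _ r) = blacks l + blacks r
blacks (node black l _ r) = suc (blacks l + blacks r)

redCount+blacks≡size : ∀ t → redCount t + blacks t ≡ size t
redCount+blacks≡size leaf = refl
redCount+blacks≡size (node c l _ r) = count c
  where
  children : redCount l + redCount r + (blacks l + blacks r) ≡ size l + size r
  children = trans (interchange (redCount l) (redCount r) (blacks l) (blacks r))
                   (cong₂ _+_ (redCount+blacks≡size l) (redCount+blacks≡size r))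

  count : ∀ c {k} → redCount (node c l k r) + blacks (node c l k r) ≡ suc (size l + size r)
  count red   = cong suc children
  count black = trans (+-suc _ _) (cong suc children)

RB-colour : ∀ {c h t} → RB c h t → colour t ≡ c
RB-colour leaf        = refl
RB-colour (red _ _)   = refl
RB-colour (black _ _) = refl

RB-blackCount : ∀ {c h t} → RB c h t → (p : LeafPath t) → blackCount p ≡ suc h
RB-blackCount leaf        stop      = refl
RB-blackCount (red L R)   (left p)  = RB-blackCount L p
RB-blackCount (red L R)   (right p) = RB-blackCount R p
RB-blackCount (black L R) (left p)  = cong suc (RB-blackCount L p)
RB-blackCount (black L R) (right p) = cong suc (RB-blackCount R p)

leftmost : ∀ t → LeafPath t
leftmost leaf           = stop
leftmost (node _ l _ r) = left (leftmost l)

-- Balance at a node compares any path through the left child with any path through the right one.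
-- The two `leftmost` paths serve as samples, and since each determines the height of its subtree,
-- the two heights agree.
IsRedBlack⇒RB : ∀ t → IsRedBlack t → ∃[ h ] RB (colour t) h t
IsRedBlack⇒RB t T = go t (IsRedBlack.redRule T) (IsRedBlack.balanced T)
  where
  go : ∀ t → Everywhere BlackChildrenIfRed t → Everywhere BlackBalanced t → ∃[ h ] RB (colour t) h t
  go leaf _ _ = 0 , leaf
  go (node c l k r) (rr , rl , rr′) (bal , bl , br) with go l rl bl | go r rr′ br
  ... | h , L | h′ , R
    with suc-injective (trans (sym (RB-blackCount L (leftmost l)))
           (trans (+-cancelˡ-≡ (isBlack c) _ _ (bal (left (leftmost l)) (right (leftmost r))))
                  (RB-blackCount R (leftmost r))))
  go (node black l k r) (rr , _) _ | h , L | _ , R | refl = suc h , black L R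
  go (node red   l k r) (rr , _) _ | h , L | _ , R | refl with rr refl
  ... | cl , cr = h , red (subst (λ c → RB c h l) cl L) (subst (λ c → RB c h r) cr R)

-- Restoring the key order

-- Numbers the nodes in order, starting from `lo`. Shape and colours are unaffected, so trees can be
-- constructed with arbitrary keys and made into search trees at the end.
relabel : ℕ → Tree → Tree
relabel lo leaf           = leaf
relabel lo (node c l _ r) = node c (relabel lo l) (lo + size l) (relabel (suc (lo + size l)) r)

relabel-size : ∀ lo t → size (relabel lo t) ≡ size t
relabel-size lo leaf           = refl
relabel-size lo (node c l _ r) = cong suc (cong₂ _+_ (relabel-size lo l) (relabel-size _ r))

relabel-blacks : ∀ lo t → blacks (relabel lo t) ≡ blacks t
relabel-blacks lo leaf               = refl
relabel-blacks lo (node red   l _ r) = cong₂ _+_ (relabel-blacks lo l) (relabel-blacks _ r)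
relabel-blacks lo (node black l _ r) = cong suc (cong₂ _+_ (relabel-blacks lo l) (relabel-blacks _ r))

relabel-RB : ∀ {c h t} lo → RB c h t → RB c h (relabel lo t)
relabel-RB lo leaf        = leaf
relabel-RB lo (red L R)   = red (relabel-RB lo L) (relabel-RB _ R)
relabel-RB lo (black L R) = black (relabel-RB lo L) (relabel-RB _ R)

relabel-keys : ∀ lo t → All (λ k → lo ≤ k × k < lo + size t) (keys (relabel lo t))
relabel-keys lo leaf = []
relabel-keys lo (node c l _ r) = All.++⁺
  (All.map (λ (p , q) → p , ≤-trans q (+-monoʳ-≤ lo (m≤n⇒m≤1+n (m≤m+n _ _)))) (relabel-keys lo l))
  ((m≤m+n _ _ , +-monoʳ-< lo (s≤s (m≤m+n _ _))) ∷
   All.map (λ (p , q) → ≤-trans (m≤n⇒m≤1+n (m≤m+n _ _)) p , ≤-trans q (≤-reflexive (assoc lo (size l) (size r))))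
           (relabel-keys (suc (lo + size l)) r))
  where
  assoc : ∀ a b c → suc (a + b) + c ≡ a + suc (b + c)
  assoc = solve-∀

relabel-ordered : ∀ lo t → Everywhere KeysOrdered (relabel lo t)
relabel-ordered lo leaf = tt
relabel-ordered lo (node c l _ r) =
  (All.map proj₂ (relabel-keys lo l) , All.map proj₁ (relabel-keys _ r)) ,
  relabel-ordered lo l , relabel-ordered _ r

RB⇒IsRedBlack : ∀ {c h t} → Everywhere KeysOrdered t → RB c h t → IsRedBlack t
RB⇒IsRedBlack ord T = record { ordered = ord ; redRule = redRule T ; balanced = balanced T }
  where
  redRule : ∀ {c h t} → RB c h t → Everywhere BlackChildrenIfRed t
  redRule leaf        = tt
  redRule (red L R)   = (λ _ → RB-colour L , RB-colour R) , redRule L , redRule R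
  redRule (black L R) = (λ ()) , redRule L , redRule R

  root-balanced : ∀ {c h t} → RB c h t → BlackBalanced t
  root-balanced T p q = trans (RB-blackCount T p) (sym (RB-blackCount T q))

  balanced : ∀ {c h t} → RB c h t → Everywhere BlackBalanced t
  balanced leaf          = root-balanced leaf
  balanced T@(red L R)   = root-balanced T , balanced L , balanced R
  balanced T@(black L R) = root-balanced T , balanced L , balanced R

-- Lower bound on the number of black nodes

-- ∑ᵢ₌₁ʰ ⌈(n + 1) / 4ⁱ⌉, since ⌈(n + 1) / 4⌉ = ⌊n / 4⌋ + 1.
minBlacks : ℕ → ℕ → ℕ
minBlacks zero    n = 0
minBlacks (suc h) n = minBlacks h (n ℕ./ 4) + suc (n ℕ./ 4)

minBlacks-mono : ∀ h {m n} → m ≤ n → minBlacks h m ≤ minBlacks h n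
minBlacks-mono zero    m≤n = z≤n
minBlacks-mono (suc h) m≤n = +-mono-≤ (minBlacks-mono h q≤q) (s≤s q≤q)
  where q≤q = /-monoˡ-≤ 4 m≤n

n<[1+n/4]*4 : ∀ n → n < suc (n ℕ./ 4) * 4
n<[1+n/4]*4 n = begin-strict
  n                       ≡⟨ m≡m%n+[m/n]*n n 4 ⟩
  n % 4 + n ℕ./ 4 * 4     <⟨ +-monoˡ-< (n ℕ./ 4 * 4) (m%n<n n 4) ⟩
  suc (n ℕ./ 4) * 4       ∎
  where open ≤-Reasoning

-- In terms of the leaf counts `suc x` and `suc y`, this is the subadditivity of the ceiling of a
-- quotient by 4. Joining two trees under a root adds their leaf counts.
/4-subadditive : ∀ x y → suc (x + y) ℕ./ 4 ≤ suc (x ℕ./ 4 + y ℕ./ 4)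
/4-subadditive x y = s≤s⁻¹ (m<n*o⇒m/o<n {n = suc (suc (x ℕ./ 4 + y ℕ./ 4))} {4} (begin-strict
  suc (x + y)                               <⟨ s≤s (≤-reflexive (sym (+-suc x y))) ⟩
  suc x + suc y                             ≤⟨ +-mono-≤ (n<[1+n/4]*4 x) (n<[1+n/4]*4 y) ⟩
  suc (x ℕ./ 4) * 4 + suc (y ℕ./ 4) * 4     ≡⟨ collect (x ℕ./ 4) (y ℕ./ 4) ⟩
  suc (suc (x ℕ./ 4 + y ℕ./ 4)) * 4         ∎))
  where
  open ≤-Reasoning
  collect : ∀ a b → suc a * 4 + suc b * 4 ≡ suc (suc (a + b)) * 4
  collect = solve-∀

minBlacks-subadditive : ∀ h x y → minBlacks h (suc (x + y)) ≤ minBlacks h x + minBlacks h y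
minBlacks-subadditive zero    x y = z≤n
minBlacks-subadditive (suc h) x y = begin
  minBlacks h (suc (x + y) ℕ./ 4) + suc (suc (x + y) ℕ./ 4)
    ≤⟨ +-mono-≤ (minBlacks-mono h (/4-subadditive x y)) (s≤s (/4-subadditive x y)) ⟩
  minBlacks h (suc (x ℕ./ 4 + y ℕ./ 4)) + suc (suc (x ℕ./ 4 + y ℕ./ 4))
    ≤⟨ +-monoˡ-≤ _ (minBlacks-subadditive h (x ℕ./ 4) (y ℕ./ 4)) ⟩
  minBlacks h (x ℕ./ 4) + minBlacks h (y ℕ./ 4) + suc (suc (x ℕ./ 4 + y ℕ./ 4))
    ≡⟨ regroup (minBlacks h (x ℕ./ 4)) (minBlacks h (y ℕ./ 4)) (x ℕ./ 4) (y ℕ./ 4) ⟩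
  minBlacks h (x ℕ./ 4) + suc (x ℕ./ 4) + (minBlacks h (y ℕ./ 4) + suc (y ℕ./ 4)) ∎
  where
  open ≤-Reasoning
  regroup : ∀ a b c d → a + b + suc (suc (c + d)) ≡ a + suc c + (b + suc d)
  regroup = solve-∀

/4-< : ∀ {m n} → n < 4 * m → n ℕ./ 4 < m
/4-< {m} {n} n<4m = m<n*o⇒m/o<n (subst (n <_) (*-comm 4 m) n<4m)

-- The sum for `suc h` has one more summand than the sum for `h`, the ceiling of (n + 1) / 4 ^ (h +
-- 1), and the bound on `n` makes it equal to 1. The induction peels off the common leading
-- summands.
minBlacks-suc-≤ : ∀ h {n} → n < 4 ^ suc h → minBlacks (suc h) n ≤ suc (minBlacks h n)
minBlacks-suc-≤ zero    n<4 = /4-< n<4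
minBlacks-suc-≤ (suc h) n<4^ = +-monoˡ-≤ _ (minBlacks-suc-≤ h (/4-< n<4^))

-- The largest possible number of leaves, reached when every black node has two red children. A tree
-- has one leaf more than it has keys, hence the strict inequality in `size<capacity`.
capacity : Colour → ℕ → ℕ
capacity red   h = 2 * 4 ^ h
capacity black h = 4 ^ h

capacity-≤ : ∀ c h → capacity c h ≤ 2 * 4 ^ h
capacity-≤ red   h = ≤-refl
capacity-≤ black h = m≤m+n (4 ^ h) _

size<capacity : ∀ {c h t} → RB c h t → size t < capacity c h
size<capacity leaf = s≤s z≤n
size<capacity {h = h} (red {l = l} {r = r} L R) = begin-strict
  suc (size l + size r)     <⟨ s≤s (≤-reflexive (sym (+-suc (size l) (size r)))) ⟩
  suc (size l) + suc (size r) ≤⟨ +-mono-≤ (size<capacity L) (size<capacity R) ⟩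
  4 ^ h + 4 ^ h             ≡⟨ cong (λ x → 4 ^ h + x) (+-identityʳ _) ⟨
  2 * 4 ^ h                 ∎
  where open ≤-Reasoning
size<capacity (black {c} {c′} {h} {l} {_} {r} L R) = begin-strict
  suc (size l + size r)       <⟨ s≤s (≤-reflexive (sym (+-suc (size l) (size r)))) ⟩
  suc (size l) + suc (size r) ≤⟨ +-mono-≤ (size<capacity L) (size<capacity R) ⟩
  capacity c h + capacity c′ h ≤⟨ +-mono-≤ (capacity-≤ c h) (capacity-≤ c′ h) ⟩
  2 * 4 ^ h + 2 * 4 ^ h       ≡⟨ *-distribʳ-+ (4 ^ h) 2 2 ⟨
  4 ^ suc h                   ∎
  where open ≤-Reasoning

-- Under a red root, subadditivity alone suffices. A black root raises the height by one, and the
-- root itself pays for the extra summand, which is 1 because the size is below the capacity.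
minBlacks≤blacks : ∀ {c h t} → RB c h t → minBlacks h (size t) ≤ blacks t
minBlacks≤blacks leaf = z≤n
minBlacks≤blacks {h = h} (red {l = l} {r = r} L R) =
  ≤-trans (minBlacks-subadditive h (size l) (size r)) (+-mono-≤ (minBlacks≤blacks L) (minBlacks≤blacks R))
minBlacks≤blacks T@(black {h = h} {l = l} {r = r} L R) =
  ≤-trans (minBlacks-suc-≤ h (size<capacity T))
    (s≤s (≤-trans (minBlacks-subadditive h (size l) (size r)) (+-mono-≤ (minBlacks≤blacks L) (minBlacks≤blacks R))))

-- The best black height

-- The height is the least `h` with n < 2 * 4 ^ h, that is, the least black height at which `n` keys
-- fit. The recursion is that of `minBlacks`.
data OptimalHeight : ℕ → ℕ → Set where
  base : ∀ {n} → n < 2 → OptimalHeight 0 n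
  step : ∀ {h n} → 2 ≤ n → OptimalHeight h (n ℕ./ 4) → OptimalHeight (suc h) n

-- A height `h′` at which `n` keys fit is at least `h`. The two sums share their first `h` summands,
-- and the longer one only adds more.
minBlacks-optimal : ∀ {h n} → OptimalHeight h n → ∀ h′ → n < 2 * 4 ^ h′ → minBlacks h n ≤ minBlacks h′ n
minBlacks-optimal (base _)     h′       _   = z≤n
minBlacks-optimal (step 2≤n _) zero     n<2 with () ← ≤⇒≯ 2≤n n<2
minBlacks-optimal {n = n} (step _ opt) (suc h′) n<  =
  +-monoˡ-≤ _ (minBlacks-optimal opt h′ (/4-< (subst (n <_) (rearrange (4 ^ h′)) n<)))
  where
  rearrange : ∀ a → 2 * (4 * a) ≡ 4 * (2 * a)
  rearrange = solve-∀

-- Trees attaining the bound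

-- A tree obtained from t by replacing the leaves by black nodes with 1, 2 or 3 keys
-- (red children included), d keys short of the maximum 3 (size t + 1) + size t.
record Refinement (d : ℕ) (c : Colour) (h : ℕ) (t : Tree) : Set where
  constructor refinement
  field
    tree    : Tree
    valid   : RB c (suc h) tree
    size≡   : size tree + d ≡ 4 * size t + 3
    blacks≡ : blacks tree ≡ blacks t + suc (size t)

module _ {d e h : ℕ} {l : Tree} {k : ℕ} {r : Tree} where
  private
    sizes : ∀ {x y} → x + d ≡ 4 * size l + 3 → y + e ≡ 4 * size r + 3 →
            suc (x + y) + (d + e) ≡ 4 * suc (size l + size r) + 3
    sizes {x} {y} p q = trans (lhs x y d e) (trans (cong₂ (λ a b → suc (a + b)) p q) (rhs (size l) (size r)))
      where
      lhs : ∀ x y d e → suc (x + y) + (d + e) ≡ suc ((x + d) + (y + e))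
      lhs = solve-∀
      rhs : ∀ a b → suc ((4 * a + 3) + (4 * b + 3)) ≡ 4 * suc (a + b) + 3
      rhs = solve-∀

    counts : ∀ {x y} → x ≡ blacks l + suc (size l) → y ≡ blacks r + suc (size r) →
             x + y ≡ blacks l + blacks r + suc (suc (size l + size r))
    counts refl refl = regroup (blacks l) (size l) (blacks r) (size r)
      where
      regroup : ∀ a b c d → a + suc b + (c + suc d) ≡ a + c + suc (suc (b + d))
      regroup = solve-∀

  refine-red : Refinement d black h l → Refinement e black h r → Refinement (d + e) red h (node red l k r)
  refine-red (refinement l′ L sl bl) (refinement r′ R sr br) =
    refinement (node red l′ k r′) (red L R) (sizes sl sr) (counts bl br)

  refine-black : ∀ {c c′} → Refinement d c h l → Refinement e c′ h r →
                 Refinement (d + e) black (suc h) (node black l k r)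
  refine-black (refinement l′ L sl bl) (refinement r′ R sr br) =
    refinement (node black l′ k r′) (black L R) (sizes sl sr) (cong suc (counts bl br))

-- The whole deficit goes to the rightmost leaf: its black node can give up both red children, but
-- must itself remain, so `d` is at most 2.
refine : ∀ {c h t} → RB c h t → ∀ d → d ≤ 2 → Refinement d c h t
refine leaf 0 _ =
  refinement (node black (node red leaf 0 leaf) 0 (node red leaf 0 leaf)) (black (red leaf leaf) (red leaf leaf)) refl refl
refine leaf 1 _ =
  refinement (node black (node red leaf 0 leaf) 0 leaf) (black (red leaf leaf) leaf) refl refl
refine leaf 2 _ =
  refinement (node black leaf 0 leaf) (black leaf leaf) refl refl
refine leaf (suc (suc (suc _))) (s≤s (s≤s ()))
refine (red L R)   d d≤2 = refine-red (refine L 0 z≤n) (refine R d d≤2)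
refine (black L R) d d≤2 = refine-black (refine L 0 z≤n) (refine R d d≤2)

-- One leaf cannot absorb a deficit of 3, so it is split as 1 + 2 between the two subtrees of the
-- root, which must therefore exist.
refine-3 : ∀ {c h t} → RB c h t → 1 ≤ size t → Refinement 3 c h t
refine-3 (red L R)   _ = refine-red (refine L 1 (s≤s z≤n)) (refine R 2 ≤-refl)
refine-3 (black L R) _ = refine-black (refine L 1 (s≤s z≤n)) (refine R 2 ≤-refl)

Attains : ℕ → ℕ → Set
Attains h n = ∃[ c ] ∃[ t ] (RB c h t × size t ≡ n × blacks t ≡ minBlacks h n)

minBlacks-attained : ∀ {h n} → OptimalHeight h n → Attains h n
minBlacks-attained {n = 0} (base _) = black , leaf , leaf , refl , refl
-- The root may be red, so a single key costs no black node.
minBlacks-attained {n = 1} (base _) = red , node red leaf 0 leaf , red leaf leaf , refl , refl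
minBlacks-attained {n = suc (suc _)} (base (s≤s (s≤s ())))
minBlacks-attained {suc h} {n} (step 2≤n opt) with minBlacks-attained opt
-- With n = ρ + 4 q, refining a tree on `q` keys calls for the deficit 3 - ρ.
... | c , t , T , size-t , blacks-t = go (n % 4) (m%n<n n 4) (m≡m%n+[m/n]*n n 4)
  where
  q = n ℕ./ 4

  attains : ∀ {ρ} d → d + ρ ≡ 3 → n ≡ ρ + q * 4 → Refinement d c h t → Attains (suc h) n
  attains {ρ} d d+ρ≡3 n≡ (refinement t′ T′ size-t′ blacks-t′) = c , t′ , T′ , +-cancelʳ-≡ d _ _ sizes , counts
    where
    open ≡-Reasoning
    rearrange : ∀ q d ρ → 4 * q + (d + ρ) ≡ ρ + q * 4 + d
    rearrange = solve-∀
    sizes : size t′ + d ≡ n + d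
    sizes = begin
      size t′ + d       ≡⟨ size-t′ ⟩
      4 * size t + 3    ≡⟨ cong₂ (λ x y → 4 * x + y) size-t (sym d+ρ≡3) ⟩
      4 * q + (d + ρ)   ≡⟨ rearrange q d ρ ⟩
      ρ + q * 4 + d     ≡⟨ cong (_+ d) n≡ ⟨
      n + d             ∎
    counts : blacks t′ ≡ minBlacks h q + suc q
    counts = trans blacks-t′ (cong₂ (λ x y → x + suc y) blacks-t size-t)

  go : ∀ ρ → ρ < 4 → n ≡ ρ + q * 4 → Attains (suc h) n
  -- The deficit 3 needs a nonempty tree: `q` is positive because `n` is a multiple of 4 and at
  -- least 2.
  go 0 _ eq = attains 3 refl eq (refine-3 T (subst (1 ≤_) (sym size-t) (1≤q q eq)))
    where
    1≤q : ∀ q → n ≡ q * 4 → 1 ≤ q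
    1≤q zero    n≡0 with () ← subst (2 ≤_) n≡0 2≤n
    1≤q (suc _) _ = s≤s z≤n
  go 1 _ eq = attains 2 refl eq (refine T 2 ≤-refl)
  go 2 _ eq = attains 1 refl eq (refine T 1 (s≤s z≤n))
  go 3 _ eq = attains 0 refl eq (refine T 0 z≤n)
  go (suc (suc (suc (suc _)))) (s≤s (s≤s (s≤s (s≤s ())))) _

-- The best height in terms of the logarithm

⌊⌊n/2⌋/2⌋≡n/4 : ∀ n → ⌊ ⌊ n /2⌋ /2⌋ ≡ n ℕ./ 4
⌊⌊n/2⌋/2⌋≡n/4 0 = refl
⌊⌊n/2⌋/2⌋≡n/4 1 = refl
⌊⌊n/2⌋/2⌋≡n/4 2 = refl
⌊⌊n/2⌋/2⌋≡n/4 3 = refl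
⌊⌊n/2⌋/2⌋≡n/4 (suc (suc (suc (suc n)))) =
  trans (cong suc (⌊⌊n/2⌋/2⌋≡n/4 n)) (sym (m/n≡1+[m∸n]/n {4 + n} (m≤m+n 4 n)))

⌊log₂⌋≡1+⌊log₂⌊/2⌋⌋ : ∀ n → ⌊log₂ suc (suc n) ⌋ ≡ suc ⌊log₂ ⌊ suc (suc n) /2⌋ ⌋
⌊log₂⌋≡1+⌊log₂⌊/2⌋⌋ n = cong suc (sym (⌊log₂⌊n/2⌋⌋≡⌊log₂n⌋∸1 (suc (suc n))))

-- Dividing by 4 lowers the logarithm by 2 and hence the claimed height by 1.
optimalHeight : ∀ n → OptimalHeight ⌊ suc ⌊log₂ n ⌋ /2⌋ n
optimalHeight = <-rec _ go
  where
  halved : ∀ n → 4 ≤ n → ⌊log₂ ⌊ n /2⌋ ⌋ ≡ suc ⌊log₂ n ℕ./ 4 ⌋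
  halved (suc (suc (suc (suc n)))) _ =
    trans (⌊log₂⌋≡1+⌊log₂⌊/2⌋⌋ ⌊ n /2⌋) (cong (λ m → suc ⌊log₂ m ⌋) (⌊⌊n/2⌋/2⌋≡n/4 (4 + n)))
  halved 1 (s≤s ())
  halved 2 (s≤s (s≤s ()))
  halved 3 (s≤s (s≤s (s≤s ())))

  go : ∀ n → (∀ {m} → m < n → OptimalHeight ⌊ suc ⌊log₂ m ⌋ /2⌋ m) → OptimalHeight ⌊ suc ⌊log₂ n ⌋ /2⌋ n
  go 0 _ = base (s≤s z≤n)
  go 1 _ = base (s≤s (s≤s z≤n))
  -- For 2 and 3 the quotient by 4 is 0, where `halved` fails, so they are treated directly.
  go 2 _ = step ≤-refl (base (s≤s z≤n))
  go 3 _ = step (s≤s (s≤s z≤n)) (base (s≤s z≤n))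
  go n@(suc (suc (suc (suc k)))) rec =
    subst (λ L → OptimalHeight ⌊ suc L /2⌋ n) (sym (⌊log₂⌋≡1+⌊log₂⌊/2⌋⌋ (suc (suc k))))
      (step (s≤s (s≤s z≤n))
        (subst (λ L → OptimalHeight ⌊ L /2⌋ (n ℕ./ 4)) (sym (halved n (m≤m+n 4 k)))
          (rec (/4-< (m<m+n n {3 * n} (s≤s z≤n))))))

-- Binary weights

∑<-cong : ∀ m {f g : ℕ → ℕ} → (∀ i → f i ≡ g i) → ∑< m f ≡ ∑< m g
∑<-cong zero    f≡g = refl
∑<-cong (suc m) f≡g = cong₂ _+_ (f≡g 0) (∑<-cong m (f≡g ∘ suc))

∑<-*-distribˡ : ∀ a m (f : ℕ → ℕ) → ∑[ i < m ] (a * f i) ≡ a * ∑< m f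
∑<-*-distribˡ a zero    f = sym (*-zeroʳ a)
∑<-*-distribˡ a (suc m) f =
  trans (cong (λ x → _ + x) (∑<-*-distribˡ a m (f ∘ suc))) (sym (*-distribˡ-+ a (f 0) _))

-- The number `m` of digits is free of the logarithm and leading zeros are allowed, so that
-- induction can remove two digits at a time.
value weight oddWeight : ℕ → (ℕ → Bit) → ℕ
value     m b = ∑[ i < m ] (toℕ (b i) * 2 ^ i)
weight    m b = ∑[ i < m ] toℕ (b i)
oddWeight m b = ∑[ i < ⌊ m /2⌋ ] toℕ (b (2 * i + 1))

shift₂ : (ℕ → Bit) → ℕ → Bit
shift₂ b i = b (suc (suc i))

low : (ℕ → Bit) → ℕ
low b = toℕ (b 0) + 2 * toℕ (b 1)

low<4 : ∀ b → low b < 4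
low<4 b = s≤s (+-mono-≤ (s≤s⁻¹ (toℕ<n (b 0))) (*-monoʳ-≤ 2 (s≤s⁻¹ (toℕ<n (b 1)))))

value-peel : ∀ m b → value (suc (suc m)) b ≡ low b + value m (shift₂ b) * 4
value-peel m b = trans
  (cong (λ v → toℕ (b 0) * 1 + (toℕ (b 1) * 2 + v))
    (trans (∑<-cong m (λ i → rearrange (toℕ (b (suc (suc i)))) (2 ^ i)))
           (∑<-*-distribˡ 4 m (λ i → toℕ (b (suc (suc i))) * 2 ^ i))))
  (collect (toℕ (b 0)) (toℕ (b 1)) (value m (shift₂ b)))
  where
  rearrange : ∀ x y → x * (2 * (2 * y)) ≡ 4 * (x * y)
  rearrange = solve-∀
  collect : ∀ x y v → x * 1 + (y * 2 + 4 * v) ≡ x + 2 * y + v * 4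
  collect = solve-∀

value/4 : ∀ m b → value (suc (suc m)) b ℕ./ 4 ≡ value m (shift₂ b)
value/4 m b = begin
  value (suc (suc m)) b ℕ./ 4                   ≡⟨ cong (ℕ._/ 4) (value-peel m b) ⟩
  (low b + v * 4) ℕ./ 4                         ≡⟨ +-distrib-/-∣ʳ (low b) (n∣m*n v) ⟩
  low b ℕ./ 4 + v * 4 ℕ./ 4                     ≡⟨ cong₂ _+_ (m<n⇒m/n≡0 (low<4 b)) (m*n/n≡m v 4) ⟩
  v                                             ∎
  where
  open ≡-Reasoning
  v = value m (shift₂ b)

oddWeight-peel : ∀ m b → oddWeight (suc (suc m)) b ≡ toℕ (b 1) + oddWeight m (shift₂ b)
oddWeight-peel m b = cong (λ x → toℕ (b 1) + x) (∑<-cong ⌊ m /2⌋ (λ i → cong (toℕ ∘ b) (reindex i)))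
  where
  reindex : ∀ i → 2 * suc i + 1 ≡ suc (suc (2 * i + 1))
  reindex = solve-∀

-- A form of Legendre's formula in base 4: the base-4 digits are b₀ + 2 b₁, so `weight` plus
-- `oddWeight` is the base-4 digit sum, and `minBlacks` sums the quotients by powers of 4, plus 1
-- for each. When two bits are removed, b₀ + 2 b₁ splits as b₀ + b₁ and b₁ between the weights, and
-- 4 v + 3 as 3 (v + 1) + v.
weights-minBlacks : ∀ m b →
  value m b + 3 * ⌊ m /2⌋ ≡ weight m b + oddWeight m b + 3 * minBlacks ⌊ m /2⌋ (value m b)
weights-minBlacks 0 b = refl
weights-minBlacks 1 b = one (toℕ (b 0))
  where
  one : ∀ x → x * 1 + 0 + 0 ≡ x + 0 + 0 + 0
  one = solve-∀
weights-minBlacks (suc (suc m)) b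
  rewrite value/4 m b | oddWeight-peel m b = begin
    value (suc (suc m)) b + 3 * suc h      ≡⟨ cong (_+ 3 * suc h) (value-peel m b) ⟩
    b₀ + 2 * b₁ + v * 4 + 3 * suc h        ≡⟨ lhs b₀ b₁ v h ⟩
    b₀ + 2 * b₁ + 3 * suc v + (v + 3 * h)  ≡⟨ cong (λ x → b₀ + 2 * b₁ + 3 * suc v + x) (weights-minBlacks m (shift₂ b)) ⟩
    b₀ + 2 * b₁ + 3 * suc v + (w + o + 3 * g) ≡⟨ rhs b₀ b₁ v w o g ⟩
    b₀ + (b₁ + w) + (b₁ + o) + 3 * (g + suc v) ∎
  where
  open ≡-Reasoning
  b₀ = toℕ (b 0)
  b₁ = toℕ (b 1)
  h = ⌊ m /2⌋
  v = value m (shift₂ b)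
  w = weight m (shift₂ b)
  o = oddWeight m (shift₂ b)
  g = minBlacks h v
  lhs : ∀ x y v h → x + 2 * y + v * 4 + 3 * suc h ≡ x + 2 * y + 3 * suc v + (v + 3 * h)
  lhs = solve-∀
  rhs : ∀ x y v w o g →
    x + 2 * y + 3 * suc v + (w + o + 3 * g) ≡ x + (y + w) + (y + o) + 3 * (g + suc v)
  rhs = solve-∀

-- Passage to the rationals

-- Normalisation in `_/_` blocks computation on variables. Among unnormalised fractions the laws for
-- `ι` become integer identities.
ι≃ : ∀ a → ℚ.toℚᵘ (ι a) ℚᵘ.≃ mkℚᵘ (+ a) 0
ι≃ a = ℚ.toℚᵘ-fromℚᵘ (mkℚᵘ (+ a) 0)

ι-+ : ∀ a b → ι (a + b) ≡ ι a ℚ.+ ι b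
ι-+ a b = ℚ.toℚᵘ-injective (begin
  ℚ.toℚᵘ (ι (a + b))               ≈⟨ ι≃ (a + b) ⟩
  mkℚᵘ (+ (a + b)) 0               ≈⟨ *≡* (cong (ℤ._* (+ 1)) (sym (cong₂ ℤ._+_ (ℤ.*-identityʳ (+ a)) (ℤ.*-identityʳ (+ b))))) ⟩
  mkℚᵘ (+ a) 0 ℚᵘ.+ mkℚᵘ (+ b) 0   ≈⟨ ℚᵘ.+-cong (ι≃ a) (ι≃ b) ⟨
  ℚ.toℚᵘ (ι a) ℚᵘ.+ ℚ.toℚᵘ (ι b)   ≈⟨ ℚ.toℚᵘ-homo-+ (ι a) (ι b) ⟨
  ℚ.toℚᵘ (ι a ℚ.+ ι b)             ∎)
  where open ℚᵘ.≃-Reasoning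

ι-* : ∀ a b → ι (a * b) ≡ ι a ℚ.* ι b
ι-* a b = ℚ.toℚᵘ-injective (begin
  ℚ.toℚᵘ (ι (a * b))               ≈⟨ ι≃ (a * b) ⟩
  mkℚᵘ (+ (a * b)) 0               ≈⟨ *≡* (cong (ℤ._* (+ 1)) (ℤ.pos-* a b)) ⟩
  mkℚᵘ (+ a) 0 ℚᵘ.* mkℚᵘ (+ b) 0   ≈⟨ ℚᵘ.*-cong (ι≃ a) (ι≃ b) ⟨
  ℚ.toℚᵘ (ι a) ℚᵘ.* ℚ.toℚᵘ (ι b)   ≈⟨ ℚ.toℚᵘ-homo-* (ι a) (ι b) ⟨
  ℚ.toℚᵘ (ι a ℚ.* ι b)             ∎)
  where open ℚᵘ.≃-Reasoning

ι-third-minus : ∀ r h {x} → 3 * (r + h) ≡ x → ι r ≡ (+ 1 / 3) ℚ.* ι x ℚ.- ι h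
ι-third-minus r h refl = sym (begin
  ⅓ ℚ.* ι (3 * (r + h)) ℚ.- ι h      ≡⟨ cong (λ y → ⅓ ℚ.* y ℚ.- ι h) (ι-* 3 (r + h)) ⟩
  ⅓ ℚ.* (ι 3 ℚ.* ι (r + h)) ℚ.- ι h  ≡⟨ cong (ℚ._- ι h) (ℚ.*-assoc ⅓ (ι 3) (ι (r + h))) ⟨
  -- The product `⅓ ℚ.* ι 3` evaluates to `ι 1`, so associativity is all that has to be cited.
  ι 1 ℚ.* ι (r + h) ℚ.- ι h          ≡⟨ cong (ℚ._- ι h) (ℚ.*-identityˡ (ι (r + h))) ⟩
  ι (r + h) ℚ.- ι h                  ≡⟨ cong (ℚ._- ι h) (ι-+ r h) ⟩
  ι r ℚ.+ ι h ℚ.- ι h                ≡⟨ ℚ.+-assoc (ι r) (ι h) (ℚ.- ι h) ⟩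
  ι r ℚ.+ (ι h ℚ.- ι h)              ≡⟨ cong (ι r ℚ.+_) (ℚ.+-inverseʳ (ι h)) ⟩
  ι r ℚ.+ ι 0                        ≡⟨ ℚ.+-identityʳ (ι r) ⟩
  ι r                                ∎)
  where
  open ≡-Reasoning
  ⅓ = + 1 / 3

-- The maximum and its closed form

-- Red and black nodes together make up all `n` keys, so maximising the red ones means minimising
-- the black ones.
maxRedCount : ∀ {h n} → OptimalHeight h n → ∃[ r ] (IsMaxRedCount n r × r + minBlacks h n ≡ n)
maxRedCount {h} {n} opt with minBlacks-attained opt
... | c , t , T , size-t , blacks-t =
  redCount t₀ , record { attained = t₀ , RB⇒IsRedBlack (relabel-ordered 0 t) (relabel-RB 0 T) , size-t₀ , refl
                       ; upperBound = upperBound } , reds-t₀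
  where
  t₀ = relabel 0 t

  size-t₀ : size t₀ ≡ n
  size-t₀ = trans (relabel-size 0 t) size-t

  reds-t₀ : redCount t₀ + minBlacks h n ≡ n
  reds-t₀ = trans (cong (λ x → _ + x) (sym (trans (relabel-blacks 0 t) blacks-t)))
                  (trans (redCount+blacks≡size t₀) size-t₀)

  upperBound : ∀ t′ → IsRedBlack t′ → size t′ ≡ n → redCount t′ ≤ redCount t₀
  upperBound t′ R′ refl with IsRedBlack⇒RB t′ R′
  ... | h′ , T′ = +-cancelʳ-≤ (minBlacks h (size t′)) _ _ (begin
    redCount t′ + minBlacks h (size t′) ≤⟨ +-monoʳ-≤ _ (≤-trans (minBlacks-optimal opt h′ size<) (minBlacks≤blacks T′)) ⟩
    redCount t′ + blacks t′             ≡⟨ redCount+blacks≡size t′ ⟩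
    size t′                             ≡⟨ reds-t₀ ⟨
    redCount t₀ + minBlacks h (size t′) ∎)
    where
    open ≤-Reasoning
    size< = <-≤-trans (size<capacity T′) (capacity-≤ (colour t′) h′)

theorem4 : (n : ℕ) → 1 ≤ n → (b : ℕ → Bit) → IsBinaryExpansion n b →
    ∃[ r ] (IsMaxRedCount n r ×
    ι r ≡ (+ 1 / 3) ℚ.* ι (2 * n + binaryWeight n b + oddBinaryWeight n b) ℚ.- ι ⌊ suc ⌊log₂ n ⌋ /2⌋)
theorem4 n _ b expansion with maxRedCount (optimalHeight n)
-- Adding `3 * g` to both sides avoids subtraction and reduces the claim to `r+g≡n` and `weights`.
... | r , r-max , r+g≡n = r , r-max , ι-third-minus r h (+-cancelʳ-≡ (3 * g) (3 * (r + h)) (2 * n + a + o) (begin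
  3 * (r + h) + 3 * g     ≡⟨ lhs r h g ⟩
  2 * (r + g) + (r + g + 3 * h) ≡⟨ cong (λ m → 2 * m + (m + 3 * h)) r+g≡n ⟩
  2 * n + (n + 3 * h)     ≡⟨ cong (λ x → 2 * n + x) weights ⟩
  2 * n + (a + o + 3 * g) ≡⟨ rhs (2 * n) a o (3 * g) ⟩
  2 * n + a + o + 3 * g   ∎))
  where
  open ≡-Reasoning
  h = ⌊ suc ⌊log₂ n ⌋ /2⌋
  g = minBlacks h n
  a = binaryWeight n b
  o = oddBinaryWeight n b
  weights : n + 3 * h ≡ a + o + 3 * g
  -- Only the value is rewritten to `n`; the digit count stays tied to the logarithm, so that
  -- `weight` and `oddWeight` are the two binary weights by definition.
  weights = subst (λ v → v + 3 * h ≡ a + o + 3 * minBlacks h v) (sym expansion)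
                  (weights-minBlacks (suc ⌊log₂ n ⌋) b)
  lhs : ∀ r h g → 3 * (r + h) + 3 * g ≡ 2 * (r + g) + (r + g + 3 * h)
  lhs = solve-∀
  rhs : ∀ x a o y → x + (a + o + y) ≡ x + a + o + y
  rhs = solve-∀
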